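{- In the directed cut-matching game on $n$ vertices there is a cut player strategy such that, after $O(\log^2 n)$ rounds, the union of the directed matchings played by the matching player is an Eulerian graph with edge expansion $\Omega(\log n)$, regardless of the matching player's choices.
   Context: The directed cut-matching game on a vertex set $V$ with $|V|=n$ ($n$ even) starts from the empty graph. In each round the cut player chooses a bisection $(S,\overline S)$ of $V$, and the matching player then chooses a directed perfect matching between $S$ and $\overline S$, i.e. a directed graph whose edges go between $S$ and $\overline S$ and in which every vertex has in-degree exactly one and out-degree exactly one (hence it is Eulerian). The union of the matchings is the multigraph of all edges played. The edge expansion of a directed (multi)graph $H$ on $V$ is $\min_{\emptyset\neq S\subsetneq V}\frac{\min\{|\delta_H^+(S)|,|\delta_H^-(S)|\}}{\min\{|S|,|\overline S|\}}$, where $\delta^+_H(S)$ (resp. $\delta^-_H(S)$) is the multiset of edges of $H$ leaving (resp. entering) $S$. -}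

module Defs where

open import Data.Nat using (ℕ; zero; suc; _⊓_)
open import Data.Integer using (+_)
open import Data.Rational as ℚ using (ℚ; 0ℚ; _/_)
open import Data.Fin using (Fin)
open import Data.Fin.Properties using (_≟_)
open import Data.Fin.Subset using (Subset; inside; outside; _∈_; _∉_; ⊤; ∁; ∣_∣)
open import Data.Fin.Subset.Properties using (_∈?_; _⊂?_; nonempty?)
open import Data.List using (List; []; _∷_; [_]; _++_; map; filter; foldr; length; concat)
open import Data.List.Relation.Unary.All using (All)
open import Data.Product using (_×_; proj₁; proj₂)
open import Data.Sum using (_⊎_)
open import Data.Vec using ([]; _∷_)
open import Relation.Binary.PropositionalEquality using (_≡_)
open import Relation.Nullary.Decidable using (¬?; _×-dec_)

-- A directed multigraph on the vertex set Fin n, as its list of edges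
-- (tail , head), repeated according to multiplicity.
DiGraph : ℕ → Set
DiGraph n = List (Fin n × Fin n)

module _ {n : ℕ} where

  outDegree inDegree : DiGraph n → Fin n → ℕ
  outDegree H v = length (filter (λ e → proj₁ e ≟ v) H)
  inDegree  H v = length (filter (λ e → proj₂ e ≟ v) H)

  -- In the directed setting Eulerian means balanced; connectivity is not
  -- required (a single directed matching counts as Eulerian).
  Eulerian : DiGraph n → Set
  Eulerian H = ∀ v → inDegree H v ≡ outDegree H v

  δ⁺ δ⁻ : DiGraph n → Subset n → DiGraph n
  δ⁺ H S = filter (λ e → (proj₁ e ∈? S) ×-dec ¬? (proj₂ e ∈? S)) H
  δ⁻ H S = filter (λ e → ¬? (proj₁ e ∈? S) ×-dec (proj₂ e ∈? S)) H

subsets : ∀ n → List (Subset n)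
subsets zero    = [ [] ]
subsets (suc n) = map (outside ∷_) (subsets n) ++ map (inside ∷_) (subsets n)

properSubsets : ∀ n → List (Subset n)
properSubsets n = filter (λ S → nonempty? S ×-dec (S ⊂? ⊤)) (subsets n)

-- The zero-denominator clause is a junk value; it does not arise for the
-- subsets in properSubsets.
ratio : ℕ → ℕ → ℚ
ratio a zero    = 0ℚ
ratio a (suc b) = + a / suc b

-- The empty-list clause is a junk value; properSubsets n is empty only for n ≤ 1.
minimum : List ℚ → ℚ
minimum []       = 0ℚ
minimum (q ∷ qs) = foldr ℚ._⊓_ q qs

cutExpansion : ∀ {n} → DiGraph n → Subset n → ℚ
cutExpansion H S = ratio (length (δ⁺ H S) ⊓ length (δ⁻ H S)) (∣ S ∣ ⊓ ∣ ∁ S ∣)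

edgeExpansion : ∀ {n} → DiGraph n → ℚ
edgeExpansion {n} H = minimum (map (cutExpansion H) (properSubsets n))

record Bisection (n : ℕ) : Set where
  field
    side     : Subset n
    balanced : ∣ side ∣ ≡ ∣ ∁ side ∣

open Bisection public

record IsDirectedMatching {n : ℕ} (B : Bisection n) (M : DiGraph n) : Set where
  field
    crossing     : All (λ e → (proj₁ e ∈ side B × proj₂ e ∉ side B)
                            ⊎ (proj₁ e ∉ side B × proj₂ e ∈ side B)) M
    inDegree≡1  : ∀ v → inDegree M v ≡ 1
    outDegree≡1 : ∀ v → outDegree M v ≡ 1

-- The matchings played so far, most recent first.
History : ℕ → Set
History n = List (DiGraph n)

-- The cut player's own past bisections are determined by the strategy and
-- the past matchings, so they need not be part of the input.
CutStrategy : ℕ → Set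
CutStrategy n = History n → Bisection n

-- Play σ h : h is a possible history of the game when the cut player follows σ
-- and the matching player answers each bisection with an arbitrary directed
-- perfect matching.
data Play {n : ℕ} (σ : CutStrategy n) : History n → Set where
  start : Play σ []
  round : ∀ {h M} → Play σ h → IsDirectedMatching (σ h) M → Play σ (M ∷ h)

union : ∀ {n} → History n → DiGraph n
union = concat

{-# OPTIONS --safe #-}
module Submission where

-- A directed perfect matching is a permutation of the vertices, so every cut
-- has as many leaving as entering edges. In each round the cut player takes a
-- largest set U with at most n/2 vertices and at most |U|/20 leaving edges, and
-- plays a bisection with U on one side (after Khandekar, Khot, Orecchia and
-- Vishnoi).
--
-- If |U| < n/8, the graph expands after that round: a set W with at most n/2
-- vertices has |W ∖ U| = O(cut W), because otherwise W ∪ U or its complement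
-- would be a sparse set larger than U, and the matching sends W ∩ U out of U,
-- that is, out of W or into W ∖ U.
--
-- If |U| ≥ n/8, the entropy of the lazy random walk along the matchings grows by
-- a constant per vertex: few edges leave U, so most of the walk mass that
-- started in U is still there, and it is averaged with nearly empty vertices
-- outside U. The total entropy is at most O(log n) per vertex, so within
-- O(log n) rounds the first case occurs and the expansion is at least 1/80.
-- Repeating this from scratch ⌈log₂ n⌉ times adds up the cuts.

open import Defs
open import Data.Nat using (ℕ; zero; suc; _+_; _*_; _^_; _∸_; _⊓_; ⌈_/2⌉; _≤_; _<_; z≤n; s≤s; >-nonZero)
open import Data.Nat.Properties
open import Data.Nat.Divisibility using (_∣_; divides)
open import Data.Nat.DivMod using (_%_; [m+kn]%n≡m%n; m<n⇒m%n≡m)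
open import Data.Nat.Induction using (<-rec)
open import Data.Nat.Logarithm using (⌈log₂_⌉; ⌈log₂⌉-mono-≤; ⌈log₂⌈n/2⌉⌉≡⌈log₂n⌉∸1)
open import Data.Nat.Tactic.RingSolver using (solve-∀)
open import Data.Nat.ListAction using () renaming (sum to sumₗ)
open import Algebra.Properties.Semiring.Sum +-*-semiring
  using (sum; sum-syntax; sum-cong-≗; sum-replicate-zero; ∑-distrib-+; ∑-comm; *-distribˡ-sum; *-distribʳ-sum)
open import Data.Bool using (Bool; true; false; not; _∧_; _∨_; if_then_else_)
open import Data.Integer as ℤ using (+_)
import Data.Integer.Properties as ℤ
open import Data.Rational as ℚ using (ℚ; 0ℚ; _/_; toℚᵘ)
import Data.Rational.Properties as ℚ
open import Data.Rational.Unnormalised as ℚᵘ using (mkℚᵘ; *≤*)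
import Data.Rational.Unnormalised.Properties as ℚᵘ
open import Data.Fin using (Fin; zero; suc)
import Data.Fin.Properties as Fin
open import Data.Fin.Subset using (Subset; inside; outside; ⊤; ⊥; ∣_∣; ∁; _∪_; _∉_; _⊂_; Nonempty)
open import Data.Fin.Subset.Properties using (_∈?_; ∣p∣≤n; ∣⊥∣≡0; ⊆⊤; ∈⊤; ∉⊥; nonempty?; _⊂?_; x∉p⇒x∈∁p; ∣∁p∣≡n∸∣p∣)
open import Data.Vec using ([]; _∷_; lookup; here; there)
open import Data.Vec.Properties using (lookup-map; lookup-zipWith; lookup-replicate; lookup⇒[]=; []=⇒lookup)
open import Data.List using (List; []; _∷_; [_]; _++_; length; map; filter; take; drop; foldr)
open import Data.List.Properties using (length-++; filter-++; length-take; length-drop; take++drop≡id)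
open import Data.List.Relation.Unary.All as All using (All; []; _∷_)
import Data.List.Relation.Unary.All.Properties as All
open import Data.List.Relation.Unary.Any using (here)
open import Data.List.Membership.Propositional using () renaming (_∈_ to _∈ₗ_)
open import Data.List.Membership.Propositional.Properties using (∈-++⁺ˡ; ∈-++⁺ʳ; ∈-map⁺; ∈-filter⁺)
open import Data.List.Extrema.Nat using (argmax; argmax-all; f[xs]≤f[argmax])
open import Data.Product using (Σ-syntax; _×_; _,_; proj₁; proj₂)
open import Data.Sum using (_⊎_; inj₁; inj₂)
open import Function using (_∘_; case_of_)
open import Relation.Binary.PropositionalEquality using (_≡_; refl; sym; trans; cong; cong₂; subst; subst₂; module ≡-Reasoning)
open import Relation.Nullary using (¬_; yes; no; does; contradiction)
open import Relation.Nullary.Decidable using (_×-dec_)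
open import Relation.Unary using (Decidable)

-- Finite sums

sum-mono-≤ : ∀ {n} {f g : Fin n → ℕ} → (∀ i → f i ≤ g i) → sum f ≤ sum g
sum-mono-≤ {zero}  f≤g = z≤n
sum-mono-≤ {suc n} f≤g = +-mono-≤ (f≤g zero) (sum-mono-≤ (f≤g ∘ suc))

sum-const : ∀ n c → sum {n} (λ _ → c) ≡ n * c
sum-const zero    c = refl
sum-const (suc n) c = cong (_+_ c) (sum-const n c)

term≤sum : ∀ {n} (f : Fin n → ℕ) i → f i ≤ sum f
term≤sum f zero    = m≤m+n _ _
term≤sum f (suc i) = ≤-trans (term≤sum (f ∘ suc) i) (m≤n+m _ _)

sum-point : ∀ {n} (i : Fin n) c → ∑[ j < n ] (if does (i Fin.≟ j) then c else 0) ≡ c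
sum-point {suc n} zero    c = trans (cong (_+_ c) (sum-replicate-zero n)) (+-identityʳ c)
sum-point {suc n} (suc i) c = sum-point i c

sum-pointʳ : ∀ {n} (j : Fin n) c → ∑[ i < n ] (if does (i Fin.≟ j) then c else 0) ≡ c
sum-pointʳ {suc n} zero    c = trans (cong (_+_ c) (sum-replicate-zero n)) (+-identityʳ c)
sum-pointʳ {suc n} (suc j) c = sum-pointʳ j c

sum₂ : ∀ {n} → (Fin n → Fin n → ℕ) → ℕ
sum₂ {n} f = ∑[ u < n ] ∑[ v < n ] f u v

module _ {n : ℕ} where

  sum₂-mono-≤ : {f g : Fin n → Fin n → ℕ} → (∀ u v → f u v ≤ g u v) → sum₂ f ≤ sum₂ g
  sum₂-mono-≤ f≤g = sum-mono-≤ λ u → sum-mono-≤ (f≤g u)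

  sum₂-cong : {f g : Fin n → Fin n → ℕ} → (∀ u v → f u v ≡ g u v) → sum₂ f ≡ sum₂ g
  sum₂-cong f≡g = sum-cong-≗ λ u → sum-cong-≗ (f≡g u)

  sum₂-distrib-+ : ∀ (f g : Fin n → Fin n → ℕ) → sum₂ (λ u v → f u v + g u v) ≡ sum₂ f + sum₂ g
  sum₂-distrib-+ f g = trans (sum-cong-≗ λ u → ∑-distrib-+ (f u) (g u)) (∑-distrib-+ (sum ∘ f) (sum ∘ g))

  *-distribˡ-sum₂ : ∀ c (f : Fin n → Fin n → ℕ) → c * sum₂ f ≡ sum₂ (λ u v → c * f u v)
  *-distribˡ-sum₂ c f = trans (*-distribˡ-sum c (sum ∘ f)) (sum-cong-≗ λ u → *-distribˡ-sum c (f u))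

χ : Bool → ℕ
χ true  = 1
χ false = 0

∣∣≡∑χ : ∀ {n} (S : Subset n) → ∣ S ∣ ≡ ∑[ v < n ] χ (lookup S v)
∣∣≡∑χ []            = refl
∣∣≡∑χ (true ∷ S)  = cong suc (∣∣≡∑χ S)
∣∣≡∑χ (false ∷ S) = ∣∣≡∑χ S

-- cap K a w = ∑_{j ≤ K} min (w , 2 ^ j * a), a piecewise linear substitute for
-- the entropy function w log (1/w).

cap : ℕ → ℕ → ℕ → ℕ
cap zero    a w = w ⊓ a
cap (suc K) a w = w ⊓ a + cap K (2 * a) w

cap-≤ : ∀ K a w → cap K a w ≤ suc K * w
cap-≤ zero    a w = ≤-trans (m⊓n≤m w a) (m≤m+n w 0)
cap-≤ (suc K) a w = +-mono-≤ (m⊓n≤m w a) (cap-≤ K (2 * a) w)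

⊓-superadditive : ∀ a p q → p ⊓ a + q ⊓ a ≤ (p + q) ⊓ (2 * a)
⊓-superadditive a p q = ⊓-glb (+-mono-≤ (m⊓n≤m p a) (m⊓n≤m q a))
  (+-mono-≤ (m⊓n≤n p a) (≤-trans (m⊓n≤n q a) (m≤m+n a 0)))

interchange : ∀ a b c d → (a + b) + (c + d) ≡ (a + c) + (b + d)
interchange = solve-∀

-- A round averages two masses while the integer scale doubles. Midpoint concavity of `min`,
-- threshold by threshold, thus says that averaging never lowers the potential relative to the
-- scale.
cap-superadditive : ∀ K a p q → cap K a p + cap K a q ≤ cap K (2 * a) (p + q)
cap-superadditive zero    a p q = ⊓-superadditive a p q
cap-superadditive (suc K) a p q = ≤-trans
  (≤-reflexive (interchange (p ⊓ a) _ (q ⊓ a) _))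
  (+-mono-≤ (⊓-superadditive a p q) (cap-superadditive K (2 * a) p q))

-- Under these bounds `(p + q) ⊓ (2 * a)` is exactly `2 * a`, so averaging gains at least `a - q`,
-- which is at least `p / 4 - q`.
⊓-gain : ∀ a p q → 2 * a ≤ p → p ≤ 4 * a →
  4 * (p ⊓ a + q ⊓ a) + p ≤ 4 * ((p + q) ⊓ (2 * a)) + 4 * q
⊓-gain a p q 2a≤p p≤4a = begin
  4 * (p ⊓ a + q ⊓ a) + p             ≤⟨ +-mono-≤ (*-monoʳ-≤ 4 (+-mono-≤ (m⊓n≤n p a) (m⊓n≤m q a))) p≤4a ⟩
  4 * (a + q) + 4 * a                 ≡⟨ lemma a q ⟩
  4 * (2 * a) + 4 * q                 ≡⟨ cong (λ x → 4 * x + 4 * q) (m≥n⇒m⊓n≡n (≤-trans 2a≤p (m≤m+n p q))) ⟨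
  4 * ((p + q) ⊓ (2 * a)) + 4 * q     ∎
  where
  open ≤-Reasoning
  lemma : ∀ a q → 4 * (a + q) + 4 * a ≡ 4 * (2 * a) + 4 * q
  lemma = solve-∀

-- Thresholds double, so one of them lies between `p / 4` and `p / 2`. The recursion searches for
-- it; `⊓-gain` applies there and superadditivity handles all the others.
cap-gain : ∀ K a p q → 2 * a ≤ p → p ≤ 4 * (2 ^ K * a) →
  4 * (cap K a p + cap K a q) + p ≤ 4 * cap K (2 * a) (p + q) + 4 * q
cap-gain zero    a p q 2a≤p p≤ = ⊓-gain a p q 2a≤p (subst (λ x → p ≤ 4 * x) (*-identityˡ a) p≤)
cap-gain (suc K) a p q 2a≤p p≤ with p ≤? 4 * a
... | yes p≤4a = begin
  4 * (p ⊓ a + cap K (2 * a) p + (q ⊓ a + cap K (2 * a) q)) + p   ≡⟨ lemma (p ⊓ a) _ (q ⊓ a) _ p ⟩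
  4 * (p ⊓ a + q ⊓ a) + p + 4 * (cap K (2 * a) p + cap K (2 * a) q) ≤⟨ +-mono-≤ (⊓-gain a p q 2a≤p p≤4a) (*-monoʳ-≤ 4 (cap-superadditive K (2 * a) p q)) ⟩
  4 * ((p + q) ⊓ (2 * a)) + 4 * q + 4 * cap K (2 * (2 * a)) (p + q) ≡⟨ lemma′ ((p + q) ⊓ (2 * a)) q _ ⟩
  4 * ((p + q) ⊓ (2 * a) + cap K (2 * (2 * a)) (p + q)) + 4 * q ∎
  where
  open ≤-Reasoning
  lemma : ∀ x y z w p → 4 * (x + y + (z + w)) + p ≡ 4 * (x + z) + p + 4 * (y + w)
  lemma = solve-∀
  lemma′ : ∀ x q y → 4 * x + 4 * q + 4 * y ≡ 4 * (x + y) + 4 * q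
  lemma′ = solve-∀
... | no  p≰4a = begin
  4 * (p ⊓ a + cap K (2 * a) p + (q ⊓ a + cap K (2 * a) q)) + p   ≡⟨ lemma (p ⊓ a) _ (q ⊓ a) _ p ⟩
  4 * (p ⊓ a + q ⊓ a) + (4 * (cap K (2 * a) p + cap K (2 * a) q) + p) ≤⟨ +-mono-≤ (*-monoʳ-≤ 4 (⊓-superadditive a p q)) (cap-gain K (2 * a) p q 4a≤p p≤′) ⟩
  4 * ((p + q) ⊓ (2 * a)) + (4 * cap K (2 * (2 * a)) (p + q) + 4 * q) ≡⟨ lemma′ ((p + q) ⊓ (2 * a)) _ q ⟩
  4 * ((p + q) ⊓ (2 * a) + cap K (2 * (2 * a)) (p + q)) + 4 * q ∎
  where
  open ≤-Reasoning
  lemma : ∀ x y z w p → 4 * (x + y + (z + w)) + p ≡ 4 * (x + z) + (4 * (y + w) + p)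
  lemma = solve-∀
  lemma′ : ∀ x y q → 4 * x + (4 * y + 4 * q) ≡ 4 * (x + y) + 4 * q
  lemma′ = solve-∀
  double : ∀ a → 4 * a ≡ 2 * (2 * a)
  double = solve-∀
  shift : ∀ x a → 2 * x * a ≡ x * (2 * a)
  shift = solve-∀
  4a≤p : 2 * (2 * a) ≤ p
  4a≤p = subst (_≤ p) (double a) (≰⇒≥ p≰4a)
  p≤′ : p ≤ 4 * (2 ^ K * (2 * a))
  p≤′ = subst (λ x → p ≤ 4 * x) (shift (2 ^ K) a) p≤

-- Matchings as permutations of the vertices

module _ {n : ℕ} where

  private
    headOr : Fin n → DiGraph n → Fin n
    headOr v []      = v
    headOr v (e ∷ _) = proj₂ e

  -- The default in `headOr` is never reached for a matching, where every vertex has exactly one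
  -- out-edge.
  partner : DiGraph n → Fin n → Fin n
  partner M v = headOr v (filter (λ e → proj₁ e Fin.≟ v) M)

  outEdges : ∀ M v → outDegree M v ≡ 1 → filter (λ e → proj₁ e Fin.≟ v) M ≡ [ (v , partner M v) ]
  outEdges M v deg with filter (λ e → proj₁ e Fin.≟ v) M | All.all-filter (λ e → proj₁ e Fin.≟ v) M
  outEdges M v refl | (x , y) ∷ [] | refl ∷ [] = refl

  -- Bijectivity enters only through the invariance of sums; taking this as the definition avoids
  -- carrying an inverse.
  Permuting : (Fin n → Fin n) → Set
  Permuting f = ∀ (g : Fin n → ℕ) → sum (g ∘ f) ≡ sum g

  sum-fibres : ∀ {A : Set} (k : A → Fin n) (g : A → ℕ) xs →
    sumₗ (map g xs) ≡ ∑[ v < n ] sumₗ (map g (filter (λ x → k x Fin.≟ v) xs))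
  sum-fibres k g [] = sym (sum-replicate-zero n)
  sum-fibres k g (x ∷ xs) = begin
    g x + sumₗ (map g xs)
      ≡⟨ cong₂ _+_ (sym (sum-point (k x) (g x))) (sum-fibres k g xs) ⟩
    ∑[ v < n ] (if does (k x Fin.≟ v) then g x else 0) + ∑[ v < n ] sumₗ (map g (filter (λ y → k y Fin.≟ v) xs))
      ≡⟨ ∑-distrib-+ {n} (λ v → if does (k x Fin.≟ v) then g x else 0) _ ⟨
    ∑[ v < n ] ((if does (k x Fin.≟ v) then g x else 0) + sumₗ (map g (filter (λ y → k y Fin.≟ v) xs)))
      ≡⟨ sum-cong-≗ step ⟩
    ∑[ v < n ] sumₗ (map g (filter (λ y → k y Fin.≟ v) (x ∷ xs))) ∎
    where
    open ≡-Reasoning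
    step : ∀ v → (if does (k x Fin.≟ v) then g x else 0) + sumₗ (map g (filter (λ y → k y Fin.≟ v) xs))
               ≡ sumₗ (map g (filter (λ y → k y Fin.≟ v) (x ∷ xs)))
    step v with does (k x Fin.≟ v)
    ... | true  = refl
    ... | false = refl

  sum-edges : ∀ M → (∀ v → outDegree M v ≡ 1) → ∀ (g : Fin n × Fin n → ℕ) →
    sumₗ (map g M) ≡ ∑[ v < n ] g (v , partner M v)
  sum-edges M deg g = trans (sum-fibres proj₁ g M) (sum-cong-≗ λ v →
    trans (cong (sumₗ ∘ map g) (outEdges M v (deg v))) (+-identityʳ _))

  -- Double counting of `g` over the heads of all edges: grouped by tail it gives
  -- `sum (g ∘ partner M)`, grouped by head it gives `sum g`.
  partner-permuting : ∀ M → (∀ v → inDegree M v ≡ 1) → (∀ v → outDegree M v ≡ 1) → Permuting (partner M)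
  partner-permuting M indeg outdeg g = trans (sym (sum-edges M outdeg (g ∘ proj₂)))
    (trans (sum-fibres proj₂ (g ∘ proj₂) M) (sum-cong-≗ λ v → single v (indeg v)))
    where
    single : ∀ v → inDegree M v ≡ 1 → sumₗ (map (g ∘ proj₂) (filter (λ e → proj₂ e Fin.≟ v) M)) ≡ g v
    single v deg with filter (λ e → proj₂ e Fin.≟ v) M | All.all-filter (λ e → proj₂ e Fin.≟ v) M
    single v refl | (x , y) ∷ [] | refl ∷ [] = +-identityʳ _

  Swaps : Subset n → (Fin n → Fin n) → Set
  Swaps A f = ∀ v → lookup A (f v) ≡ not (lookup A v)

  -- Besides `Permuting`, this is all that the two cases of a round use about the answer to a
  -- bisection around `U`.
  LeavesAtOnce : Subset n → (Fin n → Fin n) → Set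
  LeavesAtOnce U f = ∀ v → lookup U v ≡ true → lookup U (f v) ≡ false

  ∉⇒lookup : ∀ (S : Subset n) v → v ∉ S → lookup S v ≡ false
  ∉⇒lookup S v v∉S with lookup S v in eq
  ... | true  = contradiction (lookup⇒[]= v S eq) v∉S
  ... | false = refl

  partner-swaps : ∀ {B M} → IsDirectedMatching B M → Swaps (side B) (partner M)
  partner-swaps {B} {M} isM v
    with subst (All _) (outEdges M v (outDegree≡1 v)) (All.filter⁺ (λ e → proj₁ e Fin.≟ v) crossing)
    where open IsDirectedMatching isM
  ... | inj₁ (v∈ , w∉) ∷ [] = trans (∉⇒lookup (side B) _ w∉) (cong not (sym ([]=⇒lookup v∈)))
  ... | inj₂ (v∉ , w∈) ∷ [] = trans ([]=⇒lookup w∈) (cong not (sym (∉⇒lookup (side B) v v∉)))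

-- Cuts

does-∈? : ∀ {n} v (S : Subset n) → does (v ∈? S) ≡ lookup S v
does-∈? zero    (true  ∷ S) = refl
does-∈? zero    (false ∷ S) = refl
does-∈? (suc v) (s ∷ S) = does-∈? v S

length-filter-χ : ∀ {A : Set} {P : A → Set} (P? : Decidable P) xs →
  length (filter P? xs) ≡ sumₗ (map (χ ∘ does ∘ P?) xs)
length-filter-χ P? [] = refl
length-filter-χ P? (x ∷ xs) with does (P? x)
... | true  = cong suc (length-filter-χ P? xs)
... | false = length-filter-χ P? xs

module _ {n : ℕ} where

  cutOf : (Fin n → Fin n) → Subset n → ℕ
  cutOf f S = ∑[ v < n ] χ (lookup S v ∧ not (lookup S (f v)))

  cut : History n → Subset n → ℕ
  cut []      S = 0
  cut (M ∷ h) S = cutOf (partner M) S + cut h S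

  -- Together with the edges inside `S`, the entering edges count `S` by heads and the leaving edges
  -- count `S` by tails.
  cutOf-entering : ∀ {f} → Permuting f → ∀ S →
    ∑[ v < n ] χ (not (lookup S v) ∧ lookup S (f v)) ≡ cutOf f S
  cutOf-entering {f} perm S = +-cancelʳ-≡ (∑[ v < n ] χ (lookup S v ∧ lookup S (f v))) _ _ (begin
    sum entering + sum staying   ≡⟨ ∑-distrib-+ entering staying ⟨
    ∑[ v < n ] (entering v + staying v) ≡⟨ sum-cong-≗ (λ v → split-head (lookup S v) (lookup S (f v))) ⟩
    ∑[ v < n ] χ (lookup S (f v)) ≡⟨ perm (χ ∘ lookup S) ⟩
    ∑[ v < n ] χ (lookup S v)     ≡⟨ sum-cong-≗ (λ v → split-tail (lookup S v) (lookup S (f v))) ⟩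
    ∑[ v < n ] (leaving v + staying v) ≡⟨ ∑-distrib-+ leaving staying ⟩
    sum leaving + sum staying ∎)
    where
    open ≡-Reasoning
    entering leaving staying : Fin n → ℕ
    entering v = χ (not (lookup S v) ∧ lookup S (f v))
    leaving  v = χ (lookup S v ∧ not (lookup S (f v)))
    staying  v = χ (lookup S v ∧ lookup S (f v))
    split-head : ∀ b c → χ (not b ∧ c) + χ (b ∧ c) ≡ χ c
    split-head true  c = refl
    split-head false c = +-identityʳ _
    split-tail : ∀ b c → χ b ≡ χ (b ∧ not c) + χ (b ∧ c)
    split-tail true  true  = refl
    split-tail true  false = refl
    split-tail false c     = refl

  lookup-∁ : ∀ (S : Subset n) v → lookup (∁ S) v ≡ not (lookup S v)
  lookup-∁ S v = lookup-map v not S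

  lookup-∪ : ∀ (S T : Subset n) v → lookup (S ∪ T) v ≡ lookup S v ∨ lookup T v
  lookup-∪ S T v = lookup-zipWith _∨_ v S T

  cutOf-∁ : ∀ {f} → Permuting f → ∀ S → cutOf f (∁ S) ≡ cutOf f S
  cutOf-∁ {f} perm S = trans (sum-cong-≗ λ v → cong χ (complement v)) (cutOf-entering perm S)
    where
    not-involutive : ∀ b → not (not b) ≡ b
    not-involutive true  = refl
    not-involutive false = refl
    complement : ∀ v → (lookup (∁ S) v ∧ not (lookup (∁ S) (f v))) ≡ (not (lookup S v) ∧ lookup S (f v))
    complement v = cong₂ _∧_ (lookup-∁ S v) (trans (cong not (lookup-∁ S (f v))) (not-involutive _))

  cutOf-∪ : ∀ f S T → cutOf f (S ∪ T) ≤ cutOf f S + cutOf f T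
  cutOf-∪ f S T = ≤-trans (sum-mono-≤ pointwise) (≤-reflexive (∑-distrib-+ {n} _ _))
    where
    subadditive : ∀ s t s′ t′ → χ ((s ∨ t) ∧ not (s′ ∨ t′)) ≤ χ (s ∧ not s′) + χ (t ∧ not t′)
    subadditive true  t     true  t′    = z≤n
    subadditive true  t     false true  = z≤n
    subadditive true  t     false false = s≤s z≤n
    subadditive false true  true  t′    = z≤n
    subadditive false true  false t′    = ≤-refl
    subadditive false false s′    t′    = z≤n
    pointwise : ∀ v → χ (lookup (S ∪ T) v ∧ not (lookup (S ∪ T) (f v))) ≤ _
    pointwise v rewrite lookup-∪ S T v | lookup-∪ S T (f v) =
      subadditive (lookup S v) (lookup T v) (lookup S (f v)) (lookup T (f v))

  AllPermuting : History n → Set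
  AllPermuting = All (Permuting ∘ partner)

  cut-∁ : ∀ {h} → AllPermuting h → ∀ S → cut h (∁ S) ≡ cut h S
  cut-∁ []       S = refl
  cut-∁ (p ∷ ps) S = cong₂ _+_ (cutOf-∁ p S) (cut-∁ ps S)

  cut-∪ : ∀ h S T → cut h (S ∪ T) ≤ cut h S + cut h T
  cut-∪ []      S T = z≤n
  cut-∪ (M ∷ h) S T = ≤-trans (+-mono-≤ (cutOf-∪ (partner M) S T) (cut-∪ h S T))
    (≤-reflexive (interchange (cutOf (partner M) S) _ _ _))

  cut-++ : ∀ h k S → cut (h ++ k) S ≡ cut h S + cut k S
  cut-++ []      k S = refl
  cut-++ (M ∷ h) k S = trans (cong (_+_ (cutOf (partner M) S)) (cut-++ h k S))
    (sym (+-assoc (cutOf (partner M) S) _ _))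

-- The lazy walk that in every round stays or follows the matching edge with
-- probability 1/2 each, with probabilities multiplied by 2 ^ K * 2 ^ length h
-- so that they are integers. The factor 2 ^ K makes the thresholds
-- 2 ^ j * 2 ^ length h of the potential, j ≤ K, reach down to probability 2 ^ - K.

module _ {n : ℕ} (K : ℕ) where

  walk : History n → Fin n → Fin n → ℕ
  walk []      u v = if does (u Fin.≟ v) then 2 ^ K else 0
  -- The edge is traversed backwards, from its head `partner M v` to its tail `v`, so the definition
  -- needs no inverse permutation.
  walk (M ∷ h) u v = walk h u v + walk h u (partner M v)

  scale : History n → ℕ
  scale h = 2 ^ K * 2 ^ length h

  scale-∷ : ∀ M h → scale h + scale h ≡ scale (M ∷ h)
  scale-∷ M h = double (2 ^ K) (2 ^ length h)
    where
    double : ∀ x y → x * y + x * y ≡ x * (2 * y)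
    double = solve-∀

  walk-column : ∀ h v → ∑[ u < n ] walk h u v ≡ scale h
  walk-column []      v = trans (sum-pointʳ v (2 ^ K)) (sym (*-identityʳ _))
  walk-column (M ∷ h) v = trans (∑-distrib-+ (λ u → walk h u v) _)
    (trans (cong₂ _+_ (walk-column h v) (walk-column h _)) (scale-∷ M h))

  -- Columns have the right sum because every vertex collects from two vertices, rows because
  -- `partner M` permutes the vertices: the scaled walk is doubly stochastic.
  walk-row : ∀ {h} → AllPermuting h → ∀ u → ∑[ v < n ] walk h u v ≡ scale h
  walk-row []       u = trans (sum-point u (2 ^ K)) (sym (*-identityʳ _))
  walk-row {M ∷ h} (p ∷ ps) u = trans (∑-distrib-+ (walk h u) _)
    (trans (cong₂ _+_ (walk-row ps u) (trans (p (walk h u)) (walk-row ps u))) (scale-∷ M h))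

  leak : History n → Subset n → ℕ
  leak h S = sum₂ λ u v → χ (lookup S u ∧ not (lookup S v)) * walk h u v

  -- Mass newly escapes from `S` only backwards along an edge entering `S`. Such an edge carries at
  -- most `scale h` by `walk-column`, and there are `cutOf f S` of them.
  leak≤cut : ∀ {h} → AllPermuting h → ∀ S → leak h S ≤ scale h * cut h S
  leak≤cut {[]} [] S = ≤-reflexive (trans (sum-cong-≗ λ u → trans (sum-cong-≗ (zero-term u)) (sum-replicate-zero n))
    (trans (sum-replicate-zero n) (sym (*-zeroʳ (scale [])))))
    where
    zero-term : ∀ u v → χ (lookup S u ∧ not (lookup S v)) * walk [] u v ≡ 0
    zero-term u v with u Fin.≟ v
    ... | no _ = *-zeroʳ (χ (lookup S u ∧ not (lookup S v)))
    ... | yes refl with lookup S u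
    ...   | true  = refl
    ...   | false = refl
  leak≤cut {M ∷ h} (p ∷ ps) S = begin
    leak (M ∷ h) S
      ≤⟨ sum₂-mono-≤ pointwise ⟩
    sum₂ (λ u v → stay u v + (stay u (f v) + enter u v))
      ≡⟨ trans (sum₂-distrib-+ stay _) (cong (_+_ (sum₂ stay)) (sum₂-distrib-+ (λ u v → stay u (f v)) enter)) ⟩
    leak h S + (sum₂ (λ u v → stay u (f v)) + sum₂ enter)
      ≡⟨ cong (λ x → leak h S + (x + sum₂ enter)) (sum-cong-≗ λ u → p (stay u)) ⟩
    leak h S + (leak h S + sum₂ enter)
      ≤⟨ +-mono-≤ (leak≤cut ps S) (+-mono-≤ (leak≤cut ps S) (≤-reflexive enter≡)) ⟩
    scale h * cut h S + (scale h * cut h S + cutOf f S * scale h)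
      -- Only half of the mass of a vertex crosses the edge, so relative to the new scale the bound
      -- has a factor 2 to spare on the new matching.
      ≤⟨ m≤m+n _ (scale h * cutOf f S) ⟩
    scale h * cut h S + (scale h * cut h S + cutOf f S * scale h) + scale h * cutOf f S
      ≡⟨ rearrange (scale h) (cut h S) (cutOf f S) ⟩
    (scale h + scale h) * (cutOf f S + cut h S)
      ≡⟨ cong (_* (cutOf f S + cut h S)) (scale-∷ M h) ⟩
    scale (M ∷ h) * cut (M ∷ h) S ∎
    where
    open ≤-Reasoning
    f = partner M
    stay enter : Fin n → Fin n → ℕ
    stay  u v = χ (lookup S u ∧ not (lookup S v)) * walk h u v
    enter u v = χ (not (lookup S v) ∧ lookup S (f v)) * walk h u (f v)
    cases : ∀ s t t′ x → χ (s ∧ not t) * x ≤ χ (s ∧ not t′) * x + χ (not t ∧ t′) * x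
    cases true  true  t′    x = z≤n
    cases true  false true  x = ≤-refl
    cases true  false false x = m≤m+n _ _
    cases false t     t′    x = z≤n
    pointwise : ∀ u v → χ (lookup S u ∧ not (lookup S v)) * walk (M ∷ h) u v ≤ stay u v + (stay u (f v) + enter u v)
    pointwise u v = ≤-trans (≤-reflexive (*-distribˡ-+ (χ (lookup S u ∧ not (lookup S v))) (walk h u v) (walk h u (f v))))
      (+-monoʳ-≤ (stay u v) (cases (lookup S u) (lookup S v) (lookup S (f v)) (walk h u (f v))))
    rearrange : ∀ s c d → s * c + (s * c + d * s) + s * d ≡ (s + s) * (d + c)
    rearrange = solve-∀
    enter≡ : sum₂ enter ≡ cutOf f S * scale h
    enter≡ = begin-equality
      sum₂ enter
        ≡⟨ ∑-comm enter ⟩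
      ∑[ v < n ] ∑[ u < n ] enter u v
        ≡⟨ sum-cong-≗ (λ v → trans (sym (*-distribˡ-sum (χ (not (lookup S v) ∧ lookup S (f v))) (λ u → walk h u (f v))))
             (cong (_*_ (χ (not (lookup S v) ∧ lookup S (f v)))) (walk-column h (f v)))) ⟩
      ∑[ v < n ] (χ (not (lookup S v) ∧ lookup S (f v)) * scale h)
        ≡⟨ *-distribʳ-sum (scale h) (λ v → χ (not (lookup S v) ∧ lookup S (f v))) ⟨
      (∑[ v < n ] χ (not (lookup S v) ∧ lookup S (f v))) * scale h
        ≡⟨ cong (_* scale h) (cutOf-entering p S) ⟩
      cutOf f S * scale h ∎

  -- The entropy potential and its growth

  potential : History n → ℕ
  potential h = sum₂ λ u v → cap K (2 ^ length h) (walk h u v)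

  potential-≤ : ∀ {h} → AllPermuting h → potential h ≤ suc K * (n * scale h)
  potential-≤ {h} ps = begin
    potential h                           ≤⟨ sum₂-mono-≤ (λ u v → cap-≤ K (2 ^ length h) (walk h u v)) ⟩
    sum₂ (λ u v → suc K * walk h u v)     ≡⟨ *-distribˡ-sum₂ (suc K) (walk h) ⟨
    suc K * sum₂ (walk h)                 ≡⟨ cong (_*_ (suc K)) (trans (sum-cong-≗ (walk-row ps)) (sum-const n (scale h))) ⟩
    suc K * (n * scale h)                 ∎
    where open ≤-Reasoning

  walk≤scale : ∀ h u v → walk h u v ≤ scale h
  walk≤scale h u v = ≤-trans (term≤sum (λ u → walk h u v) u) (≤-reflexive (walk-column h v))

  -- For `u` and `v` in `U`, `cap-gain` compares the mass at `v` with that at its partner outside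
  -- `U`. The former masses total `∣ U ∣ * scale h` minus the leak, the latter at most the leak, and
  -- a pair too light for `cap-gain` costs at most `2 * 2 ^ length h`.
  potential-gain : ∀ {M h} → Permuting (partner M) → AllPermuting h → ∀ U → LeavesAtOnce U (partner M) →
    8 * potential h + ∣ U ∣ * scale h ≤ 4 * potential (M ∷ h) + (5 * leak h U + 2 * 2 ^ length h * (∣ U ∣ * ∣ U ∣))
  potential-gain {M} {h} p ps U leaves = begin
    8 * potential h + ∣ U ∣ * scale h
      ≡⟨ cong (_+_ (8 * potential h)) (sym inside+leak) ⟩
    8 * potential h + (sum₂ mass + leak h U)
      ≡⟨ regroup (potential h) (sum₂ mass) (leak h U) ⟩
    4 * (potential h + potential h) + sum₂ mass + leak h U
      ≡⟨ cong (λ x → 4 * (potential h + x) + sum₂ mass + leak h U) (sum-cong-≗ λ u → p (before u)) ⟨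
    4 * (sum₂ before + sum₂ before′) + sum₂ mass + leak h U
      ≡⟨ cong (_+ leak h U) lhs ⟨
    sum₂ (λ u v → 4 * (before u v + before′ u v) + mass u v) + leak h U
      ≤⟨ +-monoˡ-≤ (leak h U) (sum₂-mono-≤ pointwise) ⟩
    sum₂ (λ u v → 4 * after u v + (4 * arriving u v + 2 * a * both u v)) + leak h U
      ≡⟨ cong (_+ leak h U) rhs ⟩
    4 * potential (M ∷ h) + (4 * sum₂ arriving + 2 * a * sum₂ both) + leak h U
      ≤⟨ +-monoˡ-≤ (leak h U) (+-monoʳ-≤ (4 * potential (M ∷ h)) (+-mono-≤ (*-monoʳ-≤ 4 arriving≤leak) (≤-reflexive (cong (_*_ (2 * a)) both≡)))) ⟩
    4 * potential (M ∷ h) + (4 * leak h U + 2 * a * (∣ U ∣ * ∣ U ∣)) + leak h U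
      ≡⟨ collect (4 * potential (M ∷ h)) (leak h U) (2 * a * (∣ U ∣ * ∣ U ∣)) ⟩
    4 * potential (M ∷ h) + (5 * leak h U + 2 * a * (∣ U ∣ * ∣ U ∣)) ∎
    where
    open ≤-Reasoning
    f = partner M
    a = 2 ^ length h
    both before before′ after mass arriving : Fin n → Fin n → ℕ
    both     u v = χ (lookup U u) * χ (lookup U v)
    before   u v = cap K a (walk h u v)
    before′  u v = before u (f v)
    after    u v = cap K (2 * a) (walk h u v + walk h u (f v))
    mass     u v = both u v * walk h u v
    arriving u v = both u v * walk h u (f v)

    regroup : ∀ x y z → 8 * x + (y + z) ≡ 4 * (x + x) + y + z
    regroup = solve-∀
    collect : ∀ x y z → x + (4 * y + z) + y ≡ x + (5 * y + z)
    collect = solve-∀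

    lhs : sum₂ (λ u v → 4 * (before u v + before′ u v) + mass u v) ≡ 4 * (sum₂ before + sum₂ before′) + sum₂ mass
    lhs = trans (sum₂-distrib-+ (λ u v → 4 * (before u v + before′ u v)) mass) (cong (_+ sum₂ mass)
      (trans (sym (*-distribˡ-sum₂ 4 (λ u v → before u v + before′ u v))) (cong (_*_ 4) (sum₂-distrib-+ before before′))))

    rhs : sum₂ (λ u v → 4 * after u v + (4 * arriving u v + 2 * a * both u v)) ≡ 4 * sum₂ after + (4 * sum₂ arriving + 2 * a * sum₂ both)
    rhs = trans (sum₂-distrib-+ (λ u v → 4 * after u v) (λ u v → 4 * arriving u v + 2 * a * both u v))
      (cong₂ _+_ (sym (*-distribˡ-sum₂ 4 after))
        (trans (sum₂-distrib-+ (λ u v → 4 * arriving u v) (λ u v → 2 * a * both u v))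
          (cong₂ _+_ (sym (*-distribˡ-sum₂ 4 arriving)) (sym (*-distribˡ-sum₂ (2 * a) both)))))

    both≡ : sum₂ both ≡ ∣ U ∣ * ∣ U ∣
    both≡ = begin-equality
      sum₂ both                                       ≡⟨ sum-cong-≗ (λ u → *-distribˡ-sum (χ (lookup U u)) (χ ∘ lookup U)) ⟨
      ∑[ u < n ] (χ (lookup U u) * sum (χ ∘ lookup U)) ≡⟨ *-distribʳ-sum (sum (χ ∘ lookup U)) (χ ∘ lookup U) ⟨
      sum (χ ∘ lookup U) * sum (χ ∘ lookup U)         ≡⟨ cong₂ _*_ (∣∣≡∑χ U) (∣∣≡∑χ U) ⟨
      ∣ U ∣ * ∣ U ∣                                   ∎

    inside+leak : sum₂ mass + leak h U ≡ ∣ U ∣ * scale h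
    inside+leak = begin-equality
      sum₂ mass + leak h U                                   ≡⟨ sum₂-distrib-+ mass _ ⟨
      sum₂ (λ u v → mass u v + χ (lookup U u ∧ not (lookup U v)) * walk h u v)
        ≡⟨ sum₂-cong (λ u v → merge (lookup U u) (lookup U v) (walk h u v)) ⟩
      sum₂ (λ u v → χ (lookup U u) * walk h u v)             ≡⟨ sum-cong-≗ (λ u → *-distribˡ-sum (χ (lookup U u)) (walk h u)) ⟨
      ∑[ u < n ] (χ (lookup U u) * sum (walk h u))           ≡⟨ sum-cong-≗ (λ u → cong (_*_ (χ (lookup U u))) (walk-row ps u)) ⟩
      ∑[ u < n ] (χ (lookup U u) * scale h)                  ≡⟨ *-distribʳ-sum (scale h) (χ ∘ lookup U) ⟨
      sum (χ ∘ lookup U) * scale h                           ≡⟨ cong (_* scale h) (∣∣≡∑χ U) ⟨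
      ∣ U ∣ * scale h                                        ∎
      where
      merge : ∀ s t x → χ s * χ t * x + χ (s ∧ not t) * x ≡ χ s * x
      merge true  true  x = +-identityʳ _
      merge true  false x = refl
      merge false t     x = refl

    arriving≤leak : sum₂ arriving ≤ leak h U
    arriving≤leak = begin
      sum₂ arriving  ≤⟨ sum₂-mono-≤ (λ u v → outside-U (lookup U u) (lookup U v) (lookup U (f v)) (walk h u (f v)) (leaves v)) ⟩
      sum₂ (λ u v → χ (lookup U u ∧ not (lookup U (f v))) * walk h u (f v))
        ≡⟨ sum-cong-≗ (λ u → p (λ v → χ (lookup U u ∧ not (lookup U v)) * walk h u v)) ⟩
      leak h U       ∎
      where
      outside-U : ∀ s t t′ x → (t ≡ true → t′ ≡ false) → χ s * χ t * x ≤ χ (s ∧ not t′) * x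
      outside-U false t     t′ x l = z≤n
      outside-U true  false t′ x l = z≤n
      outside-U true  true  t′ x l rewrite l refl = ≤-refl

    superadditive : ∀ u v → 4 * (before u v + before′ u v) ≤ 4 * after u v
    superadditive u v = *-monoʳ-≤ 4 (cap-superadditive K a (walk h u v) (walk h u (f v)))

    weighted : ∀ u v b → b ≤ 1 →
      4 * (before u v + before′ u v) + b * walk h u v ≤ 4 * after u v + (4 * (b * walk h u (f v)) + 2 * a * b)
    weighted u v zero          _         = +-mono-≤ (superadditive u v) z≤n
    weighted u v (suc (suc _)) (s≤s ())
    weighted u v (suc zero)    _ rewrite +-identityʳ (walk h u v) | +-identityʳ (walk h u (f v)) | *-identityʳ (2 * a)
      with 2 * a ≤? walk h u v
    ... | yes 2a≤w = begin
      4 * (before u v + before′ u v) + walk h u v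
        ≤⟨ cap-gain K a (walk h u v) (walk h u (f v)) 2a≤w (≤-trans (walk≤scale h u v) (m≤m+n _ _)) ⟩
      4 * after u v + 4 * walk h u (f v)
        ≤⟨ +-monoʳ-≤ (4 * after u v) (m≤m+n _ _) ⟩
      4 * after u v + (4 * walk h u (f v) + 2 * a) ∎
    -- A light pair gains nothing; its mass is charged to the allowance `2 * a`.
    ... | no 2a≰w = +-mono-≤ (superadditive u v) (≤-trans (≰⇒≥ 2a≰w) (m≤n+m (2 * a) (4 * walk h u (f v))))

    pointwise : ∀ u v → 4 * (before u v + before′ u v) + mass u v ≤ 4 * after u v + (4 * arriving u v + 2 * a * both u v)
    pointwise u v = weighted u v (both u v) (*-mono-≤ (χ≤1 (lookup U u)) (χ≤1 (lookup U v)))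
      where
      χ≤1 : ∀ b → χ b ≤ 1
      χ≤1 true  = ≤-refl
      χ≤1 false = z≤n

  -- Relative to the scale, which doubles, the potential rises by at least `n / 128`. Sparsity
  -- controls the leak, and `8 * n ≤ 2 ^ K` makes the light pairs negligible.
  potential-growth : ∀ {M h} → Permuting (partner M) → AllPermuting h → ∀ U → LeavesAtOnce U (partner M) →
    8 * n ≤ 2 ^ K → 2 * ∣ U ∣ ≤ n → n ≤ 8 * ∣ U ∣ → 20 * cut h U ≤ ∣ U ∣ →
    128 * potential h + n * scale h ≤ 64 * potential (M ∷ h)
  potential-growth {M} {h} p ps U leaves 8n≤2^K 2s≤n n≤8s sparse = begin
    128 * potential h + n * D             ≤⟨ +-monoʳ-≤ (128 * potential h) (*-monoˡ-≤ D n≤8s) ⟩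
    128 * potential h + 8 * s * D         ≤⟨ m≤m+n _ (2 * (s * D)) ⟩
    128 * potential h + 8 * s * D + 2 * (s * D) ≡⟨ halve (potential h) s D ⟩
    2 * (64 * potential h + 5 * (s * D))  ≤⟨ *-monoʳ-≤ 2 main ⟩
    2 * (32 * potential (M ∷ h))          ≡⟨ *-assoc 2 32 (potential (M ∷ h)) ⟨
    64 * potential (M ∷ h)                ∎
    where
    open ≤-Reasoning
    D = scale h
    s = ∣ U ∣
    a = 2 ^ length h
    halve : ∀ x s D → 128 * x + 8 * s * D + 2 * (s * D) ≡ 2 * (64 * x + 5 * (s * D))
    halve = solve-∀
    expandˡ : ∀ x y → 64 * x + 5 * y + 3 * y ≡ 8 * (8 * x + y)
    expandˡ = solve-∀
    expandʳ : ∀ x l a s → 8 * (4 * x + (5 * l + 2 * a * (s * s))) ≡ 32 * x + (40 * l + 8 * (2 * s) * a * s)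
    expandʳ = solve-∀
    regroup : ∀ D c → 40 * (D * c) ≡ 2 * D * (20 * c)
    regroup = solve-∀
    triple : ∀ x D s → x + (2 * D * s + D * s) ≡ x + 3 * (s * D)
    triple = solve-∀
    main : 64 * potential h + 5 * (s * D) ≤ 32 * potential (M ∷ h)
    main = +-cancelʳ-≤ (3 * (s * D)) _ _ (begin
      64 * potential h + 5 * (s * D) + 3 * (s * D)    ≡⟨ expandˡ (potential h) (s * D) ⟩
      8 * (8 * potential h + s * D)                   ≤⟨ *-monoʳ-≤ 8 (potential-gain {M} p ps U leaves) ⟩
      8 * (4 * potential (M ∷ h) + (5 * leak h U + 2 * a * (s * s))) ≡⟨ expandʳ (potential (M ∷ h)) (leak h U) a s ⟩
      32 * potential (M ∷ h) + (40 * leak h U + 8 * (2 * s) * a * s)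
        -- Of the gain `8 * (s * D)`, sparsity limits the leak term to `2 * D * s`, and
        -- `8 * (2 * s) ≤ 8 * n ≤ 2 ^ K` limits the light pairs to `D * s`; five units remain.
        ≤⟨ +-monoʳ-≤ (32 * potential (M ∷ h)) (+-mono-≤
             (≤-trans (*-monoʳ-≤ 40 (leak≤cut ps U)) (≤-trans (≤-reflexive (regroup D (cut h U))) (*-monoʳ-≤ (2 * D) sparse)))
             (*-monoˡ-≤ s (*-monoˡ-≤ a (≤-trans (*-monoʳ-≤ 8 2s≤n) 8n≤2^K)))) ⟩
      32 * potential (M ∷ h) + (2 * D * s + D * s)    ≡⟨ triple (32 * potential (M ∷ h)) D s ⟩
      32 * potential (M ∷ h) + 3 * (s * D)            ∎)

-- The cut player's strategy

∈-subsets : ∀ {n} (S : Subset n) → S ∈ₗ subsets n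
∈-subsets []          = here refl
∈-subsets (false ∷ S) = ∈-++⁺ˡ (∈-map⁺ (outside ∷_) (∈-subsets S))
∈-subsets (true  ∷ S) = ∈-++⁺ʳ (map (outside ∷_) (subsets _)) (∈-map⁺ (inside ∷_) (∈-subsets S))

_⊑_ : ∀ {n} → Subset n → Subset n → Set
U ⊑ A = ∀ v → lookup U v ≡ true → lookup A v ≡ true

swaps⇒leavesAtOnce : ∀ {n} (U A : Subset n) f → U ⊑ A → Swaps A f → LeavesAtOnce U f
swaps⇒leavesAtOnce U A f U⊑A swaps v v∈U with lookup U (f v) in w∈U
... | false = refl
... | true  = contradiction (trans (sym (U⊑A (f v) w∈U)) (trans (swaps v) (cong not (U⊑A v v∈U)))) λ ()

superset : ∀ {n} (U : Subset n) m → ∣ U ∣ ≤ m → m ≤ n → Σ[ A ∈ Subset n ] ∣ A ∣ ≡ m × U ⊑ A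
superset [] zero _ _ = [] , refl , λ ()
superset (true ∷ U) (suc m) (s≤s U≤m) (s≤s m≤n) with superset U m U≤m m≤n
... | A , ∣A∣≡m , U⊑A = true ∷ A , cong suc ∣A∣≡m , λ { zero _ → refl ; (suc v) → U⊑A v }
superset {suc n} (false ∷ U) m U≤m m≤1+n with m ≤? n
... | yes m≤n with superset U m U≤m m≤n
...   | A , ∣A∣≡m , U⊑A = false ∷ A , ∣A∣≡m , λ { zero () ; (suc v) → U⊑A v }
-- Only `m ≡ suc n` is left, which forces the first vertex into the superset.
superset {suc n} (false ∷ U) m U≤m m≤1+n | no m≰n with ≤-antisym m≤1+n (≰⇒> m≰n)
... | refl with superset U n (∣p∣≤n U) ≤-refl
...   | A , ∣A∣≡n , U⊑A = true ∷ A , cong suc ∣A∣≡n , λ { zero () ; (suc v) → U⊑A v }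

∣∣+∣∁∣ : ∀ {n} (S : Subset n) → ∣ S ∣ + ∣ ∁ S ∣ ≡ n
∣∣+∣∁∣ S = trans (cong (_+_ ∣ S ∣) (∣∁p∣≡n∸∣p∣ S)) (m+[n∸m]≡n (∣p∣≤n S))

2∣∁∣≤n : ∀ {n} (S : Subset n) → ¬ (2 * ∣ S ∣ ≤ n) → 2 * ∣ ∁ S ∣ ≤ n
2∣∁∣≤n {n} S 2S≰n = +-cancelˡ-≤ n _ _ (begin
  n + 2 * ∣ ∁ S ∣                ≤⟨ +-monoˡ-≤ (2 * ∣ ∁ S ∣) (≰⇒≥ 2S≰n) ⟩
  2 * ∣ S ∣ + 2 * ∣ ∁ S ∣        ≡⟨ *-distribˡ-+ 2 (∣ S ∣) (∣ ∁ S ∣) ⟨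
  2 * (∣ S ∣ + ∣ ∁ S ∣)          ≡⟨ cong (_*_ 2) (∣∣+∣∁∣ S) ⟩
  2 * n                          ≡⟨ cong (_+_ n) (+-identityʳ n) ⟩
  n + n                          ∎)
  where open ≤-Reasoning

module _ {n : ℕ} where

  Sparse : History n → Subset n → Set
  Sparse h S = 2 * ∣ S ∣ ≤ n × 20 * cut h S ≤ ∣ S ∣

  sparse? : ∀ h → Decidable (Sparse h)
  sparse? h S = (2 * ∣ S ∣ ≤? n) ×-dec (20 * cut h S ≤? ∣ S ∣)

  cut-⊥ : ∀ (h : History n) → cut h ⊥ ≡ 0
  cut-⊥ []      = refl
  cut-⊥ (M ∷ h) = cong₂ _+_
    (trans (sum-cong-≗ λ v → cong (λ b → χ (b ∧ not (lookup {n = n} ⊥ (partner M v)))) (lookup-replicate v false))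
      (sum-replicate-zero n))
    (cut-⊥ h)

  -- The empty set is the default of the `argmax` below, so the maximiser is sparse in every case.
  sparse-⊥ : ∀ h → Sparse h ⊥
  sparse-⊥ h = ≤-trans (≤-reflexive (cong (_*_ 2) (∣⊥∣≡0 n))) z≤n
             , ≤-trans (≤-reflexive (cong (_*_ 20) (cut-⊥ h))) z≤n

  largestSparse : History n → Subset n
  largestSparse h = argmax ∣_∣ ⊥ (filter (sparse? h) (subsets n))

  largestSparse-sparse : ∀ h → Sparse h (largestSparse h)
  largestSparse-sparse h = argmax-all ∣_∣ (sparse-⊥ h) (All.all-filter (sparse? h) (subsets n))

  largestSparse-largest : ∀ h S → Sparse h S → ∣ S ∣ ≤ ∣ largestSparse h ∣
  largestSparse-largest h S sp = All.lookup (f[xs]≤f[argmax] ⊥ _) (∈-filter⁺ (sparse? h) (∈-subsets S) sp)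

  -- Sets with at most half of the vertices suffice, because a set and its complement have equal
  -- cuts.
  Expands : History n → Set
  Expands h = ∀ W → 2 * ∣ W ∣ ≤ n → ∣ W ∣ ≤ 80 * cut h W

  expands-∷ : ∀ M h → Expands h → Expands (M ∷ h)
  expands-∷ M h ex W 2W≤n = ≤-trans (ex W 2W≤n) (*-monoʳ-≤ 80 (m≤n+m (cut h W) (cutOf (partner M) W)))

  -- Expansion when the largest sparse set is small

  module _ {h : History n} (ps : AllPermuting h) (U : Subset n) (U-sparse : Sparse h U)
           (U-largest : ∀ S → Sparse h S → ∣ S ∣ ≤ ∣ U ∣) (U-small : 8 * ∣ U ∣ < n) where

    ∣_─U∣ ∣_∩U∣ : Subset n → ℕ
    ∣ W ─U∣ = ∑[ v < n ] χ (lookup W v ∧ not (lookup U v))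
    ∣ W ∩U∣ = ∑[ v < n ] χ (lookup W v ∧ lookup U v)

    ∣∩U∣+∣─U∣ : ∀ W → ∣ W ∣ ≡ ∣ W ∩U∣ + ∣ W ─U∣
    ∣∩U∣+∣─U∣ W = trans (∣∣≡∑χ W) (trans (sum-cong-≗ λ v → split (lookup W v) (lookup U v)) (∑-distrib-+ {n} _ _))
      where
      split : ∀ w u → χ w ≡ χ (w ∧ u) + χ (w ∧ not u)
      split true  true  = refl
      split true  false = refl
      split false u     = refl

    ∣∪U∣ : ∀ W → ∣ W ∪ U ∣ ≡ ∣ U ∣ + ∣ W ─U∣
    ∣∪U∣ W = trans (∣∣≡∑χ (W ∪ U)) (trans (sum-cong-≗ λ v → trans (cong χ (lookup-∪ W U v)) (split (lookup W v) (lookup U v)))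
      (trans (∑-distrib-+ {n} _ _) (cong (_+ ∣ W ─U∣) (sym (∣∣≡∑χ U)))))
      where
      split : ∀ w u → χ (w ∨ u) ≡ χ u + χ (w ∧ not u)
      split true  true  = refl
      split true  false = refl
      split false u     = sym (+-identityʳ _)

    cut-∪U : ∀ W → 20 * cut h (W ∪ U) ≤ 20 * cut h W + ∣ U ∣
    cut-∪U W = begin
      20 * cut h (W ∪ U)          ≤⟨ *-monoʳ-≤ 20 (cut-∪ h W U) ⟩
      20 * (cut h W + cut h U)    ≡⟨ *-distribˡ-+ 20 (cut h W) (cut h U) ⟩
      20 * cut h W + 20 * cut h U ≤⟨ +-monoʳ-≤ (20 * cut h W) (proj₂ U-sparse) ⟩
      20 * cut h W + ∣ U ∣        ∎
      where open ≤-Reasoning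

    -- If `W ∪ U` has at most half of the vertices, it either is sparse and hence no larger than
    -- `U`, or its cut exceeds `∣ W ∪ U ∣ / 20` while `U` accounts for at most `∣ U ∣ / 20` of it.
    -- Otherwise the same test is made on the complement.
    ─U-expands : ∀ W → 2 * ∣ W ∣ ≤ n → ∣ W ─U∣ ≤ 40 * cut h W
    ─U-expands W 2W≤n with 2 * ∣ W ∪ U ∣ ≤? n
    ... | yes 2X≤n with 20 * cut h (W ∪ U) ≤? ∣ W ∪ U ∣
    ...   | yes sp = ≤-trans d≤0 z≤n
      where
      d≤0 : ∣ W ─U∣ ≤ 0
      d≤0 = +-cancelˡ-≤ ∣ U ∣ _ _ (≤-trans (≤-reflexive (sym (∣∪U∣ W)))
              (≤-trans (U-largest (W ∪ U) (2X≤n , sp)) (m≤m+n ∣ U ∣ 0)))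
    ...   | no ¬sp = ≤-trans (+-cancelˡ-≤ ∣ U ∣ _ _ (begin
        ∣ U ∣ + ∣ W ─U∣        ≡⟨ ∣∪U∣ W ⟨
        ∣ W ∪ U ∣              ≤⟨ ≰⇒≥ ¬sp ⟩
        20 * cut h (W ∪ U)     ≤⟨ cut-∪U W ⟩
        20 * cut h W + ∣ U ∣   ≡⟨ +-comm (20 * cut h W) ∣ U ∣ ⟩
        ∣ U ∣ + 20 * cut h W   ∎)) (*-monoˡ-≤ (cut h W) (m≤m+n 20 20))
      where open ≤-Reasoning
    -- The complement of `W ∪ U` has at least `n / 2 - ∣ U ∣` vertices, more than `U` since
    -- `8 * ∣ U ∣ < n`, so maximality of `U` rules out that it is sparse.
    ─U-expands W 2W≤n | no 2X≰n = case (20 * cut h (∁ X) ≤? ∣ ∁ X ∣) of λ where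
        (yes sp) → contradiction (U-largest (∁ X) (2Y≤n , sp)) Y≰U
        (no ¬sp) → *-cancelˡ-≤ 2 (≤-trans 2d≤n (≤-trans (n≤80 (≰⇒≥ ¬sp)) (≤-reflexive (*-assoc 2 40 (cut h W)))))
      where
      open ≤-Reasoning
      X = W ∪ U
      d = ∣ W ─U∣
      2d≤n : 2 * d ≤ n
      2d≤n = ≤-trans (*-monoʳ-≤ 2 (≤-trans (m≤n+m d ∣ W ∩U∣) (≤-reflexive (sym (∣∩U∣+∣─U∣ W))))) 2W≤n
      n≡ : n ≡ ∣ U ∣ + d + ∣ ∁ X ∣
      n≡ = trans (sym (∣∣+∣∁∣ X)) (cong (_+ ∣ ∁ X ∣) (∣∪U∣ W))
      2Y≤n : 2 * ∣ ∁ X ∣ ≤ n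
      2Y≤n = 2∣∁∣≤n X 2X≰n
      quadruple : ∀ u d y → 4 * (u + d + y) ≡ 4 * u + 2 * (2 * d) + 4 * y
      quadruple = solve-∀
      4n≤ : 4 * n ≤ 4 * ∣ U ∣ + 2 * n + 4 * ∣ ∁ X ∣
      4n≤ = begin
        4 * n                                    ≡⟨ cong (_*_ 4) n≡ ⟩
        4 * (∣ U ∣ + d + ∣ ∁ X ∣)                ≡⟨ quadruple (∣ U ∣) d (∣ ∁ X ∣) ⟩
        4 * ∣ U ∣ + 2 * (2 * d) + 4 * ∣ ∁ X ∣    ≤⟨ +-monoˡ-≤ (4 * ∣ ∁ X ∣) (+-monoʳ-≤ (4 * ∣ U ∣) (*-monoʳ-≤ 2 2d≤n)) ⟩
        4 * ∣ U ∣ + 2 * n + 4 * ∣ ∁ X ∣          ∎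
      small : ∀ u n → 4 * u + 2 * n + 4 * u ≡ 8 * u + 2 * n
      small = solve-∀
      Y≰U : ¬ (∣ ∁ X ∣ ≤ ∣ U ∣)
      Y≰U Y≤U = <⇒≱ (begin-strict
        4 * ∣ U ∣ + 2 * n + 4 * ∣ ∁ X ∣   ≤⟨ +-monoʳ-≤ (4 * ∣ U ∣ + 2 * n) (*-monoʳ-≤ 4 Y≤U) ⟩
        4 * ∣ U ∣ + 2 * n + 4 * ∣ U ∣     ≡⟨ small ∣ U ∣ n ⟩
        8 * ∣ U ∣ + 2 * n                 <⟨ +-monoˡ-< (2 * n) U-small ⟩
        n + 2 * n                         ≤⟨ m≤n+m (n + 2 * n) n ⟩
        4 * n                             ∎) 4n≤
      four : ∀ n → 4 * n ≡ n + (n + 2 * n)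
      four = solve-∀
      rest : ∀ u n c → 4 * u + 2 * n + 4 * (20 * c + u) ≡ 80 * c + (8 * u + 2 * n)
      rest = solve-∀
      -- `2 * n ≤ 4 * (∣ U ∣ + ∣ ∁ X ∣)` with `∣ ∁ X ∣ ≤ 20 * cut h W + ∣ U ∣` and `8 * ∣ U ∣ < n`.
      -- As `2 * d ≤ n`, this yields the constant 40.
      n≤80 : ∣ ∁ X ∣ ≤ 20 * cut h (∁ X) → n ≤ 80 * cut h W
      n≤80 Y≤ = +-cancelʳ-≤ (n + 2 * n) _ _ (begin
        n + (n + 2 * n)                                   ≡⟨ four n ⟨
        4 * n                                             ≤⟨ 4n≤ ⟩
        4 * ∣ U ∣ + 2 * n + 4 * ∣ ∁ X ∣                   ≤⟨ +-monoʳ-≤ (4 * ∣ U ∣ + 2 * n) (*-monoʳ-≤ 4 Y≤cut) ⟩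
        4 * ∣ U ∣ + 2 * n + 4 * (20 * cut h W + ∣ U ∣)    ≡⟨ rest ∣ U ∣ n (cut h W) ⟩
        80 * cut h W + (8 * ∣ U ∣ + 2 * n)                ≤⟨ +-monoʳ-≤ (80 * cut h W) (+-monoˡ-≤ (2 * n) (<⇒≤ U-small)) ⟩
        80 * cut h W + (n + 2 * n)                        ∎)
        where
        Y≤cut : ∣ ∁ X ∣ ≤ 20 * cut h W + ∣ U ∣
        Y≤cut = ≤-trans Y≤ (≤-trans (≤-reflexive (cong (_*_ 20) (cut-∁ ps X))) (cut-∪U W))

    -- A vertex of `W` in `U` is sent either out of `W` or to a vertex of `W` outside `U`, and by
    -- injectivity each of the latter is hit once.
    ∩U-leaves : ∀ {f} → Permuting f → LeavesAtOnce U f → ∀ W → ∣ W ∩U∣ ≤ cutOf f W + ∣ W ─U∣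
    ∩U-leaves {f} p leaves W = begin
      ∣ W ∩U∣
        ≤⟨ sum-mono-≤ (λ v → cases (lookup W v) (lookup U v) (lookup W (f v)) (lookup U (f v)) (leaves v)) ⟩
      ∑[ v < n ] (χ (lookup W v ∧ not (lookup W (f v))) + χ (lookup W (f v) ∧ not (lookup U (f v))))
        ≡⟨ ∑-distrib-+ {n} _ _ ⟩
      cutOf f W + ∑[ v < n ] χ (lookup W (f v) ∧ not (lookup U (f v)))
        ≡⟨ cong (_+_ (cutOf f W)) (p (λ v → χ (lookup W v ∧ not (lookup U v)))) ⟩
      cutOf f W + ∣ W ─U∣ ∎
      where
      open ≤-Reasoning
      cases : ∀ w u w′ u′ → (u ≡ true → u′ ≡ false) → χ (w ∧ u) ≤ χ (w ∧ not w′) + χ (w′ ∧ not u′)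
      cases false u     w′    u′ l = z≤n
      cases true  false w′    u′ l = z≤n
      cases true  true  false u′ l = ≤-refl
      cases true  true  true  u′ l rewrite l refl = ≤-refl

    -- `W` minus `U` is counted twice, once for itself and once as a target of edges from `W ∩ U`;
    -- twice 40 gives 80.
    expands-after : ∀ M → Permuting (partner M) → LeavesAtOnce U (partner M) → Expands (M ∷ h)
    expands-after M p leaves W 2W≤n = begin
      ∣ W ∣                                              ≡⟨ ∣∩U∣+∣─U∣ W ⟩
      ∣ W ∩U∣ + ∣ W ─U∣                                  ≤⟨ +-monoˡ-≤ ∣ W ─U∣ (∩U-leaves p leaves W) ⟩
      cutOf f W + ∣ W ─U∣ + ∣ W ─U∣                      ≤⟨ +-mono-≤ (+-monoʳ-≤ (cutOf f W) (─U-expands W 2W≤n)) (─U-expands W 2W≤n) ⟩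
      cutOf f W + 40 * cut h W + 40 * cut h W            ≤⟨ m≤m+n _ (79 * cutOf f W) ⟩
      cutOf f W + 40 * cut h W + 40 * cut h W + 79 * cutOf f W ≡⟨ collect (cutOf f W) (cut h W) ⟩
      80 * (cutOf f W + cut h W)                         ∎
      where
      open ≤-Reasoning
      f = partner M
      collect : ∀ x y → x + 40 * y + 40 * y + 79 * x ≡ 80 * (x + y)
      collect = solve-∀

-- Progress within a phase

module _ {n : ℕ} (K : ℕ) where

  -- An average rise of `n / 128` per round, relative to the scale.
  LargePotential : History n → Set
  LargePotential h = length h * (n * scale K h) ≤ 128 * potential K h

  -- Expansion persists because cuts only grow. Until it holds, the size of `U` decides whether it
  -- appears now or the potential rises.
  progress : 8 * n ≤ 2 ^ K → ∀ M h → Permuting (partner M) → AllPermuting h →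
    ∀ U → Sparse h U → (∀ S → Sparse h S → ∣ S ∣ ≤ ∣ U ∣) → LeavesAtOnce U (partner M) →
    Expands h ⊎ LargePotential h → Expands (M ∷ h) ⊎ LargePotential (M ∷ h)
  progress 8n≤2^K M h p ps U sparse largest leaves (inj₁ expands) = inj₁ (expands-∷ M h expands)
  progress 8n≤2^K M h p ps U sparse largest leaves (inj₂ large) with 8 * ∣ U ∣ <? n
  ... | yes small = inj₁ (expands-after ps U sparse largest small M p leaves)
  ... | no ¬small = inj₂ (begin
    suc (length h) * (n * scale K (M ∷ h))           ≡⟨ cong (λ D → suc (length h) * (n * D)) (scale-∷ K M h) ⟨
    suc (length h) * (n * (scale K h + scale K h))   ≡⟨ regroup (length h) n (scale K h) ⟩
    2 * (length h * (n * scale K h) + n * scale K h) ≤⟨ *-monoʳ-≤ 2 (+-monoˡ-≤ (n * scale K h) large) ⟩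
    2 * (128 * potential K h + n * scale K h)        ≤⟨ *-monoʳ-≤ 2 (potential-growth K {M} p ps U leaves 8n≤2^K (proj₁ sparse) (≮⇒≥ ¬small) (proj₂ sparse)) ⟩
    2 * (64 * potential K (M ∷ h))                   ≡⟨ *-assoc 2 64 (potential K (M ∷ h)) ⟨
    128 * potential K (M ∷ h)                        ∎)
    where
    open ≤-Reasoning
    regroup : ∀ t n D → suc t * (n * (D + D)) ≡ 2 * (t * (n * D) + n * D)
    regroup = solve-∀

module _ {n : ℕ} where

  play-permuting : ∀ {σ : CutStrategy n} {h} → Play σ h → AllPermuting h
  play-permuting start = []
  play-permuting (round {M = M} play isM) = partner-permuting M inDegree≡1 outDegree≡1 ∷ play-permuting play
    where open IsDirectedMatching isM

module _ {n : ℕ} (m : ℕ) (n≡m*2 : n ≡ m * 2) where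

  bisectionAround : (U : Subset n) → 2 * ∣ U ∣ ≤ n → Σ[ B ∈ Bisection n ] U ⊑ side B
  bisectionAround U 2U≤n with superset U m U≤m m≤n
    where
    U≤m : ∣ U ∣ ≤ m
    U≤m = *-cancelˡ-≤ 2 (≤-trans 2U≤n (≤-reflexive (trans n≡m*2 (*-comm m 2))))
    m≤n : m ≤ n
    m≤n = ≤-trans (m≤m*n m 2) (≤-reflexive (sym n≡m*2))
  ... | A , ∣A∣≡m , U⊑A = record { side = A ; balanced = trans ∣A∣≡m (sym ∣∁A∣≡m) } , U⊑A
    where
    ∣∁A∣≡m : ∣ ∁ A ∣ ≡ m
    ∣∁A∣≡m = +-cancelˡ-≡ m _ _ (trans (cong (_+ ∣ ∁ A ∣) (sym ∣A∣≡m)) (trans (∣∣+∣∁∣ A)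
      (trans n≡m*2 (trans (*-comm m 2) (cong (_+_ m) (+-identityʳ m))))))

  phaseStrategy : CutStrategy n
  phaseStrategy h = proj₁ (bisectionAround (largestSparse h) (proj₁ (largestSparse-sparse h)))

  largestSparse-leaves : ∀ {h M} → IsDirectedMatching (phaseStrategy h) M → LeavesAtOnce (largestSparse h) (partner M)
  largestSparse-leaves {h} {M} isM = swaps⇒leavesAtOnce (largestSparse h) (side (phaseStrategy h)) (partner M)
    (proj₂ (bisectionAround (largestSparse h) (proj₁ (largestSparse-sparse h)))) (partner-swaps isM)

  module _ {K : ℕ} (8n≤2^K : 8 * n ≤ 2 ^ K) where

    expands⊎potential : ∀ {h} → Play phaseStrategy h → Expands h ⊎ LargePotential K h
    expands⊎potential start = inj₂ z≤n
    expands⊎potential (round {h} {M} play isM) = progress K 8n≤2^K M h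
      (All.head (play-permuting (round play isM))) (play-permuting play) (largestSparse h)
      (largestSparse-sparse h) (largestSparse-largest h) (largestSparse-leaves {h} {M} isM) (expands⊎potential {h} play)

    -- The potential never exceeds `suc K * (n * scale K h)`, which leaves room for at most
    -- `128 * suc K` rises; the phase has one round more.
    phase-expands : 0 < n → ∀ h → Play phaseStrategy h → length h ≡ suc (128 * suc K) → Expands h
    phase-expands 0<n h play len with expands⊎potential {h} play
    ... | inj₁ expands = expands
    ... | inj₂ large = contradiction too-long 1+n≰n
      where
      open ≤-Reasoning
      0<D : 0 < n * scale K h
      0<D = *-mono-< {0} 0<n (*-mono-< {0} (m^n>0 2 K) (m^n>0 2 (length h)))
      too-long : suc (128 * suc K) ≤ 128 * suc K
      too-long = *-cancelʳ-≤ _ _ (n * scale K h) {{>-nonZero 0<D}} (begin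
        suc (128 * suc K) * (n * scale K h)   ≡⟨ cong (_* (n * scale K h)) len ⟨
        length h * (n * scale K h)            ≤⟨ large ⟩
        128 * potential K h                   ≤⟨ *-monoʳ-≤ 128 (potential-≤ K {h} (play-permuting play)) ⟩
        128 * (suc K * (n * scale K h))       ≡⟨ *-assoc 128 (suc K) (n * scale K h) ⟨
        128 * suc K * (n * scale K h)         ∎)

-- Repeating a strategy in phases

take-length-++ : ∀ {A : Set} (xs ys : List A) → take (length xs) (xs ++ ys) ≡ xs
take-length-++ []       ys = refl
take-length-++ (x ∷ xs) ys = cong (x ∷_) (take-length-++ xs ys)

module _ {n : ℕ} where

  play-suffix : ∀ {σ : CutStrategy n} h k → Play σ (h ++ k) → Play σ k
  play-suffix []      k play           = play
  play-suffix (M ∷ h) k (round play _) = play-suffix h k play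

  module _ (t : ℕ) (σ : CutStrategy n) where

    -- Histories list the latest matching first, so `take` keeps exactly the rounds of the current
    -- phase and `σ` starts every phase from the empty history.
    inPhases : CutStrategy n
    inPhases h = σ (take (length h % suc t) h)

    -- Here `k` consists of completed phases. Before its latest round the current phase is strictly
    -- shorter than `suc t`, so the remainder equals its length, even if that round completes the
    -- phase.
    play-phase : ∀ j h k → length k ≡ j * suc t → length h ≤ suc t → Play inPhases (h ++ k) → Play σ h
    play-phase j []      k ∣k∣ ∣h∣≤ play = start
    play-phase j (M ∷ h) k ∣k∣ ∣h∣< (round play isM) =
      round (play-phase j h k ∣k∣ (<⇒≤ ∣h∣<) play) (subst (λ x → IsDirectedMatching (σ x) M) current isM)
      where
      position : length (h ++ k) % suc t ≡ length h
      position = trans (cong (_% suc t) (trans (length-++ h) (cong (_+_ (length h)) ∣k∣)))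
        (trans ([m+kn]%n≡m%n (length h) j (suc t)) (m<n⇒m%n≡m ∣h∣<))
      current : take (length (h ++ k) % suc t) (h ++ k) ≡ h
      current = trans (cong (λ i → take i (h ++ k)) position) (take-length-++ h k)

    -- The newest phase is by itself a play of `σ`, and cuts of successive phases add up.
    cut-inPhases : (∀ h → Play σ h → length h ≡ suc t → Expands h) →
      ∀ j h → Play inPhases h → length h ≡ j * suc t →
      ∀ W → 2 * ∣ W ∣ ≤ n → j * ∣ W ∣ ≤ 80 * cut h W
    cut-inPhases ex zero    h play len W 2W≤n = z≤n
    cut-inPhases ex (suc j) h play len W 2W≤n = begin
      ∣ W ∣ + j * ∣ W ∣                 ≤⟨ +-mono-≤ (ex now (play-phase j now past ∣past∣ (≤-reflexive ∣now∣) play′) ∣now∣ W 2W≤n)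
                                            (cut-inPhases ex j past (play-suffix now past play′) ∣past∣ W 2W≤n) ⟩
      80 * cut now W + 80 * cut past W  ≡⟨ *-distribˡ-+ 80 (cut now W) (cut past W) ⟨
      80 * (cut now W + cut past W)     ≡⟨ cong (_*_ 80) (cut-++ now past W) ⟨
      80 * cut (now ++ past) W          ≡⟨ cong (λ x → 80 * cut x W) (take++drop≡id (suc t) h) ⟩
      80 * cut h W                      ∎
      where
      open ≤-Reasoning
      now  = take (suc t) h
      past = drop (suc t) h
      play′ : Play inPhases (now ++ past)
      play′ = subst (Play inPhases) (sym (take++drop≡id (suc t) h)) play
      ∣now∣ : length now ≡ suc t
      ∣now∣ = trans (length-take (suc t) h) (m≤n⇒m⊓n≡m (≤-trans (m≤m+n (suc t) (j * suc t)) (≤-reflexive (sym len))))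
      ∣past∣ : length past ≡ j * suc t
      ∣past∣ = trans (length-drop (suc t) h) (trans (cong (_∸ suc t) len) (m+n∸m≡n (suc t) (j * suc t)))

-- From cuts of histories to the edge expansion

length-filter-++ : ∀ {A : Set} {P : A → Set} (P? : Decidable P) xs ys →
  length (filter P? (xs ++ ys)) ≡ length (filter P? xs) + length (filter P? ys)
length-filter-++ P? xs ys = trans (cong length (filter-++ P? xs ys)) (length-++ (filter P? xs))

module _ {n : ℕ} {σ : CutStrategy n} where

  union-inDegree : ∀ {h} → Play σ h → ∀ v → inDegree (union h) v ≡ length h
  union-inDegree start v = refl
  union-inDegree (round {h} {M} play isM) v = trans (length-filter-++ _ M (union h))
    (cong₂ _+_ (IsDirectedMatching.inDegree≡1 isM v) (union-inDegree play v))

  union-outDegree : ∀ {h} → Play σ h → ∀ v → outDegree (union h) v ≡ length h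
  union-outDegree start v = refl
  union-outDegree (round {h} {M} play isM) v = trans (length-filter-++ _ M (union h))
    (cong₂ _+_ (IsDirectedMatching.outDegree≡1 isM v) (union-outDegree play v))

  union-eulerian : ∀ {h} → Play σ h → Eulerian (union h)
  union-eulerian play v = trans (union-inDegree play v) (sym (union-outDegree play v))

  length-δ⁺ : ∀ {h} → Play σ h → ∀ S → length (δ⁺ (union h) S) ≡ cut h S
  length-δ⁺ start S = refl
  length-δ⁺ (round {h} {M} play isM) S = trans (length-filter-++ _ M (union h)) (cong₂ _+_
    (trans (length-filter-χ _ M) (trans (sum-edges M (IsDirectedMatching.outDegree≡1 isM) _)
      (sum-cong-≗ λ v → cong χ (cong₂ _∧_ (does-∈? v S) (cong not (does-∈? (partner M v) S))))))
    (length-δ⁺ play S))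

  length-δ⁻ : ∀ {h} → Play σ h → ∀ S → length (δ⁻ (union h) S) ≡ cut h S
  length-δ⁻ start S = refl
  length-δ⁻ (round {h} {M} play isM) S = trans (length-filter-++ _ M (union h)) (cong₂ _+_
    (trans (length-filter-χ _ M) (trans (sum-edges M outDegree≡1 _)
      (trans (sum-cong-≗ λ v → cong χ (cong₂ _∧_ (cong not (does-∈? v S)) (does-∈? (partner M v) S)))
        (cutOf-entering (partner-permuting M inDegree≡1 outDegree≡1) S))))
    (length-δ⁻ play S))
    where open IsDirectedMatching isM

ratio-≥ : ∀ l a b → 0 < b → l * b ≤ 80 * a → (+ 1 / 80) ℚ.* (+ l / 1) ℚ.≤ ratio a b
ratio-≥ l a (suc b) _ le = ℚ.toℚᵘ-cancel-≤ (begin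
  toℚᵘ ((+ 1 / 80) ℚ.* (+ l / 1))         ≃⟨ ℚ.toℚᵘ-homo-* (+ 1 / 80) (+ l / 1) ⟩
  toℚᵘ (+ 1 / 80) ℚᵘ.* toℚᵘ (+ l / 1)     ≃⟨ ℚᵘ.*-congˡ {toℚᵘ (+ 1 / 80)} (ℚ.toℚᵘ-fromℚᵘ (mkℚᵘ (+ l) 0)) ⟩
  mkℚᵘ (+ 1) 79 ℚᵘ.* mkℚᵘ (+ l) 0         ≤⟨ *≤* cross ⟩
  mkℚᵘ (+ a) b                            ≃⟨ ℚ.toℚᵘ-fromℚᵘ (mkℚᵘ (+ a) b) ⟨
  toℚᵘ (+ a / suc b)                      ∎)
  where
  open ℚᵘ.≤-Reasoning
  cross : (+ 1 ℤ.* + l) ℤ.* + suc b ℤ.≤ + a ℤ.* + 80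
  cross = subst₂ ℤ._≤_
    (trans (ℤ.pos-* l (suc b)) (cong (ℤ._* + suc b) (sym (ℤ.*-identityˡ (+ l)))))
    (trans (cong +_ (*-comm 80 a)) (ℤ.pos-* a 80))
    (ℤ.+≤+ le)

-- The member `x` excludes the empty list, where `minimum` takes its junk value.
minimum-≥ : ∀ {A : Set} (f : A → ℚ) {q x} xs → x ∈ₗ xs → All (λ y → q ℚ.≤ f y) xs → q ℚ.≤ minimum (map f xs)
minimum-≥ f {q} (x ∷ xs) _ (q≤x ∷ q≤xs) = bound xs q≤xs
  where
  bound : ∀ xs → All (λ y → q ℚ.≤ f y) xs → q ℚ.≤ foldr ℚ._⊓_ (f x) (map f xs)
  bound []       []           = q≤x
  bound (y ∷ xs) (q≤y ∷ q≤xs) = ℚ.⊓-glb q≤y (bound xs q≤xs)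

nonempty⇒∣∣>0 : ∀ {n} {S : Subset n} → Nonempty S → 0 < ∣ S ∣
nonempty⇒∣∣>0 {S = true  ∷ S} _                  = s≤s z≤n
nonempty⇒∣∣>0 {S = false ∷ S} (suc v , there v∈S) = nonempty⇒∣∣>0 (v , v∈S)

singleton-proper : ∀ {n} → (true ∷ ⊥) ∈ₗ properSubsets (2 + n)
singleton-proper {n} = ∈-filter⁺ (λ S → nonempty? S ×-dec (S ⊂? ⊤)) (∈-subsets (true ∷ ⊥))
  ((zero , here) , ⊆⊤ , suc zero , ∈⊤ , λ { (there v∈⊥) → ∉⊥ v∈⊥ })

edgeExpansion-≥ : ∀ {n l} {σ : CutStrategy n} {h} → Play σ h → 2 ≤ n →
  (∀ W → 2 * ∣ W ∣ ≤ n → l * ∣ W ∣ ≤ 80 * cut h W) →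
  (+ 1 / 80) ℚ.* (+ l / 1) ℚ.≤ edgeExpansion (union h)
edgeExpansion-≥ {suc (suc n)} {l} {σ} {h} play (s≤s (s≤s _)) expands =
  minimum-≥ (cutExpansion (union h)) (properSubsets _) singleton-proper
    (All.map bound (All.all-filter (λ S → nonempty? S ×-dec (S ⊂? ⊤)) (subsets (2 + n))))
  where
  smaller-side : ∀ S → l * (∣ S ∣ ⊓ ∣ ∁ S ∣) ≤ 80 * cut h S
  smaller-side S with 2 * ∣ S ∣ ≤? 2 + n
  ... | yes 2S≤n = ≤-trans (*-monoʳ-≤ l (m⊓n≤m (∣ S ∣) (∣ ∁ S ∣))) (expands S 2S≤n)
  ... | no  2S≰n = ≤-trans (*-monoʳ-≤ l (m⊓n≤n (∣ S ∣) (∣ ∁ S ∣))) (≤-trans (expands (∁ S) (2∣∁∣≤n S 2S≰n))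
                     (≤-reflexive (cong (_*_ 80) (cut-∁ (play-permuting play) S))))
  bound : ∀ {S} → Nonempty S × S ⊂ ⊤ → (+ 1 / 80) ℚ.* (+ l / 1) ℚ.≤ cutExpansion (union h) S
  -- Both sides of a proper nonempty subset are nonempty, which keeps `ratio` away from its zero
  -- denominator.
  bound {S} (ne , _ , v , _ , v∉S) = ratio-≥ l _ _ (⊓-glb (nonempty⇒∣∣>0 ne) (nonempty⇒∣∣>0 (v , x∉p⇒x∈∁p v∉S)))
    (≤-trans (smaller-side S) (≤-reflexive (cong (_*_ 80) (sym (trans
      (cong₂ _⊓_ (length-δ⁺ play S) (length-δ⁻ play S)) (⊓-idem (cut h S)))))))

-- Logarithms and the number of rounds

n≤2^⌈log₂n⌉ : ∀ n → n ≤ 2 ^ ⌈log₂ n ⌉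
n≤2^⌈log₂n⌉ = <-rec _ step
  where
  step : ∀ n → (∀ {m} → m < n → m ≤ 2 ^ ⌈log₂ m ⌉) → n ≤ 2 ^ ⌈log₂ n ⌉
  step zero                _   = z≤n
  step (suc zero)          _   = ≤-refl
  step n@(suc (suc k)) rec = begin
    n                                  ≡⟨ ⌊n/2⌋+⌈n/2⌉≡n n ⟨
    _                                  ≤⟨ +-monoˡ-≤ ⌈ n /2⌉ (⌊n/2⌋≤⌈n/2⌉ n) ⟩
    ⌈ n /2⌉ + ⌈ n /2⌉                  ≡⟨ cong (_+_ ⌈ n /2⌉) (+-identityʳ ⌈ n /2⌉) ⟨
    2 * ⌈ n /2⌉                        ≤⟨ *-monoʳ-≤ 2 (rec (⌈n/2⌉<n k)) ⟩
    2 ^ suc ⌈log₂ ⌈ n /2⌉ ⌉            ≡⟨ cong (λ l → 2 ^ suc l) (⌈log₂⌈n/2⌉⌉≡⌈log₂n⌉∸1 n) ⟩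
    2 ^ suc (⌈log₂ n ⌉ ∸ 1)            ≡⟨ cong (2 ^_) (m+[n∸m]≡n (⌈log₂⌉-mono-≤ {2} {n} (s≤s (s≤s z≤n)))) ⟩
    2 ^ ⌈log₂ n ⌉                      ∎
    where open ≤-Reasoning

-- The length from `phase-expands` at `K = 3 + l`, chosen so that `8 * n ≤ 2 ^ K` when `l` is
-- `⌈log₂ n ⌉`.
phaseLength : ℕ → ℕ
phaseLength l = suc (128 * suc (3 + l))

-- A phase has `128 * l + 513` rounds, and `1 ≤ l` absorbs the constant: `641 = 128 + 513`.
rounds-≤ : ∀ l → 1 ≤ l → l * phaseLength l ≤ 641 * l ^ 2
rounds-≤ l 1≤l = begin
  l * phaseLength l          ≡⟨ expand l ⟩
  l * (128 * l + 513 * 1)    ≤⟨ *-monoʳ-≤ l (+-monoʳ-≤ (128 * l) (*-monoʳ-≤ 513 1≤l)) ⟩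
  l * (128 * l + 513 * l)    ≡⟨ collect l ⟩
  641 * l ^ 2                ∎
  where
  open ≤-Reasoning
  expand : ∀ l → l * suc (128 * suc (3 + l)) ≡ l * (128 * l + 513 * 1)
  expand = solve-∀
  collect : ∀ l → l * (128 * l + 513 * l) ≡ 641 * (l * (l * 1))
  collect = solve-∀

8n≤2^[3+⌈log₂n⌉] : ∀ n → 8 * n ≤ 2 ^ (3 + ⌈log₂ n ⌉)
8n≤2^[3+⌈log₂n⌉] n = ≤-trans (*-monoʳ-≤ 8 (n≤2^⌈log₂n⌉ n)) (≤-reflexive (sym (^-distribˡ-+-* 2 3 ⌈log₂ n ⌉)))

mainTheorem5 : Σ[ C ∈ ℕ ] Σ[ c ∈ ℚ ] (0ℚ ℚ.< c) ×
    (∀ (n : ℕ) → 2 ∣ n → 2 ≤ n →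
    Σ[ T ∈ ℕ ] (T ≤ C * ⌈log₂ n ⌉ ^ 2) ×
    (Σ[ σ ∈ CutStrategy n ] (∀ (h : History n) → Play σ h → length h ≡ T →
    Eulerian (union h) ×
    (c ℚ.* (+ ⌈log₂ n ⌉ / 1)) ℚ.≤ edgeExpansion (union h))))
mainTheorem5 = 641 , + 1 / 80 , ℚ.*<* (ℤ.+<+ (s≤s z≤n)) , λ { n (divides m n≡m*2) 2≤n →
  let l = ⌈log₂ n ⌉
      σ = phaseStrategy m n≡m*2
  in l * phaseLength l , rounds-≤ l (⌈log₂⌉-mono-≤ 2≤n) , inPhases _ σ , λ h play len →
     union-eulerian play , edgeExpansion-≥ {l = l} {h = h} play 2≤n
       (cut-inPhases _ σ (phase-expands m n≡m*2 {3 + l} (8n≤2^[3+⌈log₂n⌉] n) (<⇒≤ 2≤n)) l h play len) }
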